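{- Let $p$ be even, and suppose that $X(p,C)$ is a triangle-free circulant graph containing a $p$-cycle for which the maximum independent subset is of size $\frac{p}{2}$. Then $$m(X(p,C))=\frac{p}{2}\binom{2|C|}{2}.$$
   Context: The (undirected) circulant graph $X(p,C)$ has node set $\mathbb{Z}/p\mathbb{Z}$. Its connection set is a subset of $\mathbb{Z}/p\mathbb{Z}$ closed under additive inverses, and $\{i,j\}$ is an edge exactly when $i-j$ lies in the connection set. The connection set is abbreviated by a subset $C\subset\{1,\ldots,\lfloor p/2\rfloor\}$ by omitting the additive inverse of each element, so that $\{i,j\}$ is an edge iff $i-j\equiv \pm c \pmod p$ for some $c\in C$; $|C|$ denotes the cardinality of this abbreviated set. An immorality of a directed acyclic graph (DAG) is an induced subgraph of the form $X\to Z\leftarrow Y$ (with $X,Y$ not adjacent). The immorality number $m(G)$ of an undirected graph $G$ is the maximum number of immoralities over all DAGs whose skeleton (underlying undirected graph) is $G$.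
   Formalization: The formal statement additionally assumes p/2 is not in C, so that the graph is 2|C|-regular; without this the claim fails, e.g. p = 6, C = {1,3} gives K_{3,3}, where m = 9 but the formula gives 18. -}

module Defs where

open import Data.Fin.Base using (Fin; toℕ; _<_)
open import Data.Fin.Properties using (any?; _<?_; toℕ<n; nonZeroIndex)
open import Data.Fin.Subset using (Subset; _∈_; ∣_∣)
open import Data.Fin.Subset.Properties using (_∈?_)
open import Data.Integer.Base as ℤ using (ℤ; +_)
import Data.Integer.Divisibility as ℤ
import Data.Integer.Properties as ℤ
open import Data.Integer.Tactic.RingSolver using (solve-∀)
open import Data.List.Base using (List; allFin; cartesianProduct; filter; length)
open import Data.Nat.Base as ℕ using (ℕ; suc; _≤_; z≤n; s≤s; NonZero)
open import Data.Nat.DivMod using (_/_; _mod_; m/n<m)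
open import Data.Nat.Divisibility using (_∣_; _∣?_; >⇒∤)
import Data.Nat.Properties as ℕ
open import Data.Product.Base using (∃; _×_; _,_; proj₁)
open import Data.Sum.Base using (_⊎_; inj₁; inj₂)
open import Function.Base using (_∘_)
open import Function.Bundles using (_⇔_)
open import Function.Definitions using (Injective)
open import Level using (Level; 0ℓ)
open import Relation.Binary.Construct.Closure.Transitive using (TransClosure)
open import Relation.Binary.Core using (Rel)
open import Relation.Binary.Definitions using (Decidable; Symmetric)
open import Relation.Binary.PropositionalEquality
  using (_≡_; cong; subst; module ≡-Reasoning)
open import Relation.Nullary using (¬_; Dec)
open import Relation.Nullary.Decidable using (_×-dec_; _⊎-dec_; ¬?)

private
  variable
    a : Level
    n : ℕ

IsMaximum : {A : Set a} → (A → ℕ) → ℕ → Set a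
IsMaximum f m = (∃ λ x → f x ≡ m) × (∀ x → f x ≤ m)

------------------------------------------------------------------------
-- Undirected simple graphs

record Graph (n : ℕ) : Set₁ where
  field
    Adj       : Rel (Fin n) 0ℓ
    adj?      : Decidable Adj
    adj-sym   : Symmetric Adj
    adj-irref : ∀ i → ¬ Adj i i

TriangleFree : Graph n → Set
TriangleFree G = ∀ x y z → ¬ (Adj x y × Adj y z × Adj z x)
  where open Graph G

-- The k-cycle is a subgraph, not necessarily an induced one.
record Cycle (G : Graph n) (k : ℕ) : Set where
  open Graph G
  field
    3≤k : 3 ≤ k

  instance
    k≢0 : NonZero k
    k≢0 = ℕ.>-nonZero (ℕ.<-≤-trans (s≤s z≤n) 3≤k)

  field
    vertex    : Fin k → Fin n
    injective : Injective _≡_ _≡_ vertex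
    adjacent  : ∀ i → Adj (vertex i) (vertex (suc (toℕ i) mod k))

Independent : Graph n → Subset n → Set
Independent G S = ∀ {x y} → x ∈ S → y ∈ S → ¬ Graph.Adj G x y

IsIndependenceNumber : Graph n → ℕ → Set
IsIndependenceNumber G = IsMaximum {A = ∃ (Independent G)} (∣_∣ ∘ proj₁)

------------------------------------------------------------------------
-- Directed acyclic graphs and immoralities

record DAG (n : ℕ) : Set₁ where
  field
    Arc     : Rel (Fin n) 0ℓ
    arc?    : Decidable Arc
    acyclic : ∀ i → ¬ TransClosure Arc i i

IsSkeletonOf : Graph n → DAG n → Set
IsSkeletonOf G D = ∀ i j → Graph.Adj G i j ⇔ (DAG.Arc D i j ⊎ DAG.Arc D j i)

module _ (D : DAG n) where
  open DAG D

  -- The triple (x , z , y) stands for x → z ← y.  As x → z ← y and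
  -- y → z ← x are the same subgraph, x < y picks one of the two triples.
  -- The arcs z → x and z → y are already excluded by acyclicity.
  IsImmorality : Fin n × Fin n × Fin n → Set
  IsImmorality (x , z , y) =
    x < y × Arc x z × Arc y z × ¬ Arc x y × ¬ Arc y x

  isImmorality? : ∀ t → Dec (IsImmorality t)
  isImmorality? (x , z , y) =
    x <? y ×-dec arc? x z ×-dec arc? y z ×-dec ¬? (arc? x y) ×-dec ¬? (arc? y x)

  immoralities : List (Fin n × Fin n × Fin n)
  immoralities = filter isImmorality?
    (cartesianProduct (allFin n) (cartesianProduct (allFin n) (allFin n)))

IsImmoralityNumber : Graph n → ℕ → Set₁
IsImmoralityNumber {n} G =
  IsMaximum {A = ∃ λ (D : DAG n) → IsSkeletonOf G D} (length ∘ immoralities ∘ proj₁)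

------------------------------------------------------------------------
-- Circulant graphs

infix 4 _≡_[mod_]

_≡_[mod_] : ℤ → ℤ → ℕ → Set
x ≡ y [mod p ] = + p ℤ.∣ x ℤ.- y

-- A subset of {1, …, ⌊p/2⌋} is encoded as a Subset (p / 2), whose element
-- k, counted from 0, stands for the number k + 1.
value : Fin n → ℕ
value k = suc (toℕ k)

-- The vertex i : Fin p is the residue class of toℕ i.
module _ (p : ℕ) (C : Subset (p / 2)) where

  CirculantAdj : Rel (Fin p) 0ℓ
  CirculantAdj i j = ∃ λ k → k ∈ C ×
    ( + toℕ i ℤ.- + toℕ j ≡ + value k [mod p ]
    ⊎ + toℕ i ℤ.- + toℕ j ≡ ℤ.- + value k [mod p ])

  private
    negate : ∀ (x y c : ℤ) → (x ℤ.- y) ≡ c [mod p ] → (y ℤ.- x) ≡ ℤ.- c [mod p ]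
    negate x y c = subst (p ∣_) (begin
      ℤ.∣ (x ℤ.- y) ℤ.- c ∣        ≡⟨ ℤ.∣-i∣≡∣i∣ ((x ℤ.- y) ℤ.- c) ⟨
      ℤ.∣ ℤ.- ((x ℤ.- y) ℤ.- c) ∣  ≡⟨ cong ℤ.∣_∣ (lemma x y c) ⟩
      ℤ.∣ (y ℤ.- x) ℤ.- ℤ.- c ∣    ∎)
      where
      open ≡-Reasoning
      lemma : ∀ x y c → ℤ.- ((x ℤ.- y) ℤ.- c) ≡ (y ℤ.- x) ℤ.- ℤ.- c
      lemma = solve-∀

    circulant-sym : Symmetric CirculantAdj
    circulant-sym {i} {j} (k , k∈C , inj₁ e) =
      k , k∈C , inj₂ (negate (+ toℕ i) (+ toℕ j) (+ value k) e)
    circulant-sym {i} {j} (k , k∈C , inj₂ e) =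
      k , k∈C , inj₁ (negate (+ toℕ i) (+ toℕ j) (ℤ.- + value k) e)

    value<p : (i : Fin p) (k : Fin (p / 2)) → value k ℕ.< p
    value<p i k = ℕ.≤-<-trans (toℕ<n k)
      (m/n<m p 2 {{nonZeroIndex i}} (s≤s (s≤s z≤n)))

    circulant-irref : ∀ i → ¬ CirculantAdj i i
    circulant-irref i (k , _ , inj₁ e) = >⇒∤ (value<p i k)
      (subst (λ d → p ∣ ℤ.∣ d ℤ.- + value k ∣)
        (ℤ.+-inverseʳ (+ toℕ i)) e)
    circulant-irref i (k , _ , inj₂ e) = >⇒∤ (value<p i k)
      (subst (λ d → p ∣ ℤ.∣ d ℤ.- ℤ.- + value k ∣)
        (ℤ.+-inverseʳ (+ toℕ i)) e)

  Circulant : Graph p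
  Circulant = record
    { Adj       = CirculantAdj
    ; adj?      = λ i j → any? λ k → k ∈? C ×-dec (p ∣? _ ⊎-dec p ∣? _)
    ; adj-sym   = λ {i} {j} → circulant-sym {i} {j}
    ; adj-irref = circulant-irref
    }

{-# OPTIONS --safe #-}

-- Counting the pairs of parents of each vertex z of a DAG with triangle-free
-- skeleton gives 2 I + Σ indeg z = Σ (indeg z)², where I is the number of
-- immoralities.  The skeleton is d-regular with d = 2 |C|, so Σ indeg z is the
-- number p d / 2 of edges, and indeg z ≤ d bounds I from above.  Equality holds
-- as soon as every in-degree is 0 or d.  Directing all edges away from a maximum
-- independent set S achieves this: the vertices of S are sources, and the p / 2
-- other vertices share p d / 2 arcs, which leaves d arcs for each of them.

module Submission where

open import Defs
open import Data.Bool.Base using (true; false; if_then_else_)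
open import Data.Fin.Base as Fin using (Fin; zero; suc; toℕ; fromℕ<)
import Data.Fin.Properties as Fin
open import Data.Fin.Subset using (Subset; _∈_; _∉_; ∣_∣; ∁)
open import Data.Fin.Subset.Properties
  using (_∈?_; ∣∁p∣≡n∸∣p∣; x∉p⇒x∈∁p)
open import Data.Integer.Base as ℤ using (ℤ)
import Data.Integer.Divisibility.Signed as ℤ
import Data.Integer.DivMod as ℤ
import Data.Integer.Properties as ℤ
import Data.Integer.Tactic.RingSolver as ℤ
open import Data.List.Base as List using (List; cartesianProduct; filter; length)
open import Data.List.Properties using (filter-++; length-++)
open import Data.Nat.Base
open import Data.Nat.Combinatorics using (nC1≡n; nCk+nC[k+1]≡[n+1]C[k+1])
  renaming (_C_ to _choose_)
open import Data.Nat.Divisibility using (_∣_; _∣?_; >⇒∤)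
open import Data.Nat.DivMod using (_/_; m/n*n≡m)
open import Data.Nat.Properties
open import Data.Nat.Tactic.RingSolver using (solve-∀)
open import Data.Product.Base using (∃; _×_; _,_; proj₁)
open import Data.Sum.Base using (_⊎_; inj₁; inj₂; [_,_]′)
open import Data.Vec.Base using ([]; _∷_)
open import Function.Base using (_∘_; id)
open import Function.Bundles using (_⇔_; mk⇔; Equivalence)
open import Level using (Level)
open import Relation.Binary.Construct.Closure.Transitive
  using (TransClosure; [_]; _∷_)
open import Relation.Binary.Definitions using (tri<; tri≈; tri>)
open import Relation.Binary.PropositionalEquality
open import Relation.Nullary using (¬_; Dec; yes; no; does; contradiction)
open import Relation.Nullary.Decidable
  using (_×-dec_; _⊎-dec_; ¬?; dec-true; dec-false; does-⇔)
open import Relation.Unary using (Pred; Decidable)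

open import Algebra.Properties.Semiring.Sum +-*-semiring
  using (sum; ∑-comm; ∑-distrib-+; sum-cong-≗; sum-replicate-zero;
         *-distribˡ-sum; *-distribʳ-sum)

private
  variable
    a ℓ : Level
    P Q : Set ℓ
    n : ℕ

-- Finite sums, indicator functions and list lengths

sum-mono-≤ : {f g : Fin n → ℕ} → (∀ i → f i ≤ g i) → sum f ≤ sum g
sum-mono-≤ {zero}  f≤g = z≤n
sum-mono-≤ {suc n} f≤g = +-mono-≤ (f≤g zero) (sum-mono-≤ (f≤g ∘ suc))

-- Without slack in the total there is none in any term. This later turns a count of all arcs into
-- the in-degree of each single vertex.
sum-≡⇒≗ : {f g : Fin n → ℕ} → (∀ i → f i ≤ g i) → sum f ≡ sum g → f ≗ g
sum-≡⇒≗ {suc n} {f} {g} f≤g eq = λ where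
    zero    → head≡
    (suc i) → sum-≡⇒≗ (f≤g ∘ suc) tail≡ i
  where
  head≡ : f zero ≡ g zero
  -- Bounding the tail of `f` by that of `g` gives `g zero + sum (f ∘ suc) ≤ f zero + sum (f ∘
  -- suc)`, and the tail cancels.
  head≡ = ≤-antisym (f≤g zero) (+-cancelʳ-≤ (sum (f ∘ suc)) _ _
    (≤-trans (+-monoʳ-≤ (g zero) (sum-mono-≤ (f≤g ∘ suc))) (≤-reflexive (sym eq))))

  tail≡ : sum (f ∘ suc) ≡ sum (g ∘ suc)
  tail≡ = +-cancelˡ-≡ (f zero) _ _ (trans eq (cong (_+ _) (sym head≡)))

sum-const : ∀ n c → sum {n} (λ _ → c) ≡ n * c
sum-const zero    c = refl
sum-const (suc n) c = cong (c +_) (sum-const n c)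

-- Only the Boolean is inspected, so `𝟙` computes in step with `filter` and with decisions obtained
-- by mapping other decisions.
𝟙 : Dec P → ℕ
𝟙 P? = if does P? then 1 else 0

𝟙-yes : (P? : Dec P) → P → 𝟙 P? ≡ 1
𝟙-yes P? p = cong (if_then 1 else 0) (dec-true P? p)

𝟙-no : (P? : Dec P) → ¬ P → 𝟙 P? ≡ 0
𝟙-no P? ¬p = cong (if_then 1 else 0) (dec-false P? ¬p)

𝟙-cong : P ⇔ Q → (P? : Dec P) (Q? : Dec Q) → 𝟙 P? ≡ 𝟙 Q?
𝟙-cong P⇔Q P? Q? = cong (if_then 1 else 0) (does-⇔ P⇔Q P? Q?)

𝟙-× : (P? : Dec P) (Q? : Dec Q) → 𝟙 (P? ×-dec Q?) ≡ 𝟙 P? * 𝟙 Q?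
𝟙-× (yes _) Q? = sym (*-identityˡ _)
𝟙-× (no _)  Q? = refl

𝟙-⊎ : ¬ (P × Q) → (P? : Dec P) (Q? : Dec Q) → 𝟙 (P? ⊎-dec Q?) ≡ 𝟙 P? + 𝟙 Q?
𝟙-⊎ ¬pq (yes p) Q? = cong suc (sym (𝟙-no Q? (λ q → ¬pq (p , q))))
𝟙-⊎ ¬pq (no _)  Q? = refl

∑-𝟙-none : {P : Pred (Fin n) ℓ} (P? : Decidable P) → (∀ i → ¬ P i) → sum (𝟙 ∘ P?) ≡ 0
∑-𝟙-none {n} P? ¬P = trans (sum-cong-≗ (λ i → 𝟙-no (P? i) (¬P i))) (sum-replicate-zero n)

∑-𝟙-one : {P : Pred (Fin n) ℓ} (P? : Decidable P) → (∀ {i j} → P i → P j → i ≡ j) →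
  ∀ i → P i → sum (𝟙 ∘ P?) ≡ 1
∑-𝟙-one P? unique zero p = cong₂ _+_ (𝟙-yes (P? zero) p)
  (∑-𝟙-none (P? ∘ suc) λ i q → Fin.0≢1+n (unique p q))
∑-𝟙-one P? unique (suc i) p = cong₂ _+_
  (𝟙-no (P? zero) λ q → Fin.0≢1+n (unique q p))
  (∑-𝟙-one (P? ∘ suc) (λ p q → Fin.suc-injective (unique p q)) i p)

-- Replaces the decision of an existential by a sum over candidate witnesses, which can then be
-- exchanged with other sums.
∑-𝟙-unique : {P : Pred (Fin n) ℓ} (P? : Decidable P) → (∀ {i j} → P i → P j → i ≡ j) →
  (∃P? : Dec (∃ P)) → sum (𝟙 ∘ P?) ≡ 𝟙 ∃P?
∑-𝟙-unique P? unique (yes (i , p)) = ∑-𝟙-one P? unique i p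
∑-𝟙-unique P? unique (no ¬∃)       = ∑-𝟙-none P? (λ i p → ¬∃ (i , p))

∑-𝟙-∈ : (S : Subset n) → sum (λ i → 𝟙 (i ∈? S)) ≡ ∣ S ∣
∑-𝟙-∈ []          = refl
∑-𝟙-∈ (true  ∷ S) = cong suc (∑-𝟙-∈ S)
∑-𝟙-∈ (false ∷ S) = ∑-𝟙-∈ S

module _ {A : Set a} {P : Pred A ℓ} (P? : Decidable P) where

  length-filter-tabulate : (f : Fin n → A) →
    length (filter P? (List.tabulate f)) ≡ sum (λ i → 𝟙 (P? (f i)))
  length-filter-tabulate {zero}  f = refl
  length-filter-tabulate {suc n} f with does (P? (f zero))
  ... | true  = cong suc (length-filter-tabulate (f ∘ suc))
  ... | false = length-filter-tabulate (f ∘ suc)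

  length-filter-map : {B : Set} (f : B → A) (xs : List B) →
    length (filter P? (List.map f xs)) ≡ length (filter (P? ∘ f) xs)
  length-filter-map f List.[] = refl
  length-filter-map f (x List.∷ xs) with does (P? (f x))
  ... | true  = cong suc (length-filter-map f xs)
  ... | false = length-filter-map f xs

-- `allFin n` is `tabulate id`; the general `f` is what lets the induction pass to `f ∘ suc`.
length-filter-cartesianProduct : {A B : Set} {P : Pred (A × B) ℓ} (P? : Decidable P)
  (f : Fin n → A) (ys : List B) →
  length (filter P? (cartesianProduct (List.tabulate f) ys)) ≡
  sum (λ i → length (filter (P? ∘ (f i ,_)) ys))
length-filter-cartesianProduct {n = zero}  P? f ys = refl
length-filter-cartesianProduct {n = suc n} P? f ys = begin
  length (filter P? (row List.++ rest))                    ≡⟨ cong length (filter-++ P? row rest) ⟩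
  length (filter P? row List.++ filter P? rest)            ≡⟨ length-++ (filter P? row) ⟩
  length (filter P? row) + length (filter P? rest)         ≡⟨ cong₂ _+_
    (length-filter-map P? (f zero ,_) ys) (length-filter-cartesianProduct P? (f ∘ suc) ys) ⟩
  sum (λ i → length (filter (P? ∘ (f i ,_)) ys))           ∎
  where
  open ≡-Reasoning
  row  = List.map (f zero ,_) ys
  rest = cartesianProduct (List.tabulate (f ∘ suc)) ys

-- The subtraction-free form of n(n-1)/2, by induction along Pascal's rule.
2*choose2 : ∀ n → 2 * (n choose 2) + n ≡ n * n
2*choose2 zero    = refl
2*choose2 (suc n) = begin
  2 * (suc n choose 2) + suc n        ≡⟨ cong (λ k → 2 * k + suc n) (sym (nCk+nC[k+1]≡[n+1]C[k+1] n 1)) ⟩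
  2 * (n choose 1 + m) + suc n        ≡⟨ cong (λ k → 2 * (k + m) + suc n) (nC1≡n n) ⟩
  2 * (n + m) + suc n                 ≡⟨ regroup n m ⟩
  2 * m + n + (1 + 2 * n)             ≡⟨ cong (_+ (1 + 2 * n)) (2*choose2 n) ⟩
  n * n + (1 + 2 * n)                 ≡⟨ square n ⟩
  suc n * suc n                       ∎
  where
  open ≡-Reasoning
  m = n choose 2
  regroup : ∀ n m → 2 * (n + m) + suc n ≡ 2 * m + n + (1 + 2 * n)
  regroup = solve-∀
  square : ∀ n → n * n + (1 + 2 * n) ≡ suc n * suc n
  square = solve-∀

-- Counting immoralities

degree : Graph n → Fin n → ℕ
degree G z = sum (λ x → 𝟙 (Graph.adj? G x z))

indegree : DAG n → Fin n → ℕ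
indegree D z = sum (λ x → 𝟙 (DAG.arc? D x z))

module _ (D : DAG n) where
  open DAG D

  arc-asym : ∀ {i j} → Arc i j → ¬ Arc j i
  arc-asym e f = acyclic _ (e ∷ [ f ])

  length-immoralities : length (immoralities D) ≡
    sum (λ z → sum (λ x → sum (λ y → 𝟙 (isImmorality? D (x , z , y)))))
  length-immoralities = trans
    (trans (length-filter-cartesianProduct (isImmorality? D) id _) (sum-cong-≗ λ x →
      trans (length-filter-cartesianProduct (isImmorality? D ∘ (x ,_)) id _)
        (sum-cong-≗ {n} λ z → length-filter-tabulate (isImmorality? D ∘ (x ,_) ∘ (z ,_)) id)))
    -- The common child `z` moves outermost, so that immoralities can be counted one child at a
    -- time.
    (∑-comm {n} {n} λ x z → sum (λ y → 𝟙 (isImmorality? D (x , z , y))))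

module _ (G : Graph n) (D : DAG n) (skel : IsSkeletonOf G D) where
  open Graph G
  open DAG D

  arc⇒adj : ∀ {i j} → Arc i j → Adj i j
  arc⇒adj e = Equivalence.from (skel _ _) (inj₁ e)

  indegree≤degree : ∀ z → indegree D z ≤ degree G z
  indegree≤degree z = sum-mono-≤ λ x → 𝟙-mono x (arc? x z)
    where
    𝟙-mono : ∀ x (d : Dec (Arc x z)) → 𝟙 d ≤ 𝟙 (adj? x z)
    𝟙-mono x (yes e) = ≤-reflexive (sym (𝟙-yes (adj? x z) (arc⇒adj e)))
    𝟙-mono x (no _)  = z≤n

  -- Exchanging the sums turns the second copy into the sum of out-degrees, and each edge at `z` is
  -- an arc in exactly one of the two directions.
  handshake : sum (indegree D) + sum (indegree D) ≡ sum (degree G)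
  handshake = begin
    sum (indegree D) + sum (indegree D)
      ≡⟨ cong (sum (indegree D) +_) (∑-comm {n} {n} λ z x → 𝟙 (arc? x z)) ⟩
    sum (indegree D) + sum (λ z → sum (λ x → 𝟙 (arc? z x)))
      ≡⟨ ∑-distrib-+ (indegree D) _ ⟨
    sum (λ z → indegree D z + sum (λ x → 𝟙 (arc? z x)))
      ≡⟨ sum-cong-≗ (λ z → sym (∑-distrib-+ (λ x → 𝟙 (arc? x z)) _)) ⟩
    sum (λ z → sum (λ x → 𝟙 (arc? x z) + 𝟙 (arc? z x)))
      ≡⟨ sum-cong-≗ (λ z → sum-cong-≗ λ x → trans
           (sym (𝟙-⊎ (λ (e , f) → arc-asym D e f) (arc? x z) (arc? z x)))
           (sym (𝟙-cong (skel x z) (adj? x z) (arc? x z ⊎-dec arc? z x)))) ⟩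
    sum (degree G) ∎
    where open ≡-Reasoning

  module _ (tf : TriangleFree G) where

    private
      -- An arc between two parents of `z` would close a triangle.
      parents-nonadjacent : ∀ {x y z} → Arc x z → Arc y z → ¬ Arc x y
      parents-nonadjacent e f g = tf _ _ _ (arc⇒adj g , arc⇒adj f , adj-sym (arc⇒adj e))

      imm : Fin n → Fin n → Fin n → ℕ
      imm z x y = 𝟙 (isImmorality? D (x , z , y))

      arc : Fin n → Fin n → ℕ
      arc z x = 𝟙 (arc? x z)

      imm-< : ∀ {x y} z → x Fin.< y → imm z x y ≡ arc z x * arc z y
      imm-< {x} {y} z x<y = trans
        (𝟙-cong (mk⇔ (λ (_ , e , f , _) → e , f)
                     (λ (e , f) → x<y , e , f , parents-nonadjacent e f , parents-nonadjacent f e))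
          (isImmorality? D (x , z , y)) (arc? x z ×-dec arc? y z))
        (𝟙-× (arc? x z) (arc? y z))

      imm-≮ : ∀ {x y} z → ¬ x Fin.< y → imm z x y ≡ 0
      imm-≮ {x} {y} z x≮y = 𝟙-no (isImmorality? D (x , z , y)) (x≮y ∘ proj₁)

      -- By trichotomy at most one of the three terms on the left survives: an ordered pair of
      -- parents is an immorality in one of its two orders, or lies on the diagonal.
      parent-pairs : ∀ z x y →
        imm z x y + imm z y x + 𝟙 (x Fin.≟ y) * arc z x ≡ arc z x * arc z y
      parent-pairs z x y with Fin.<-cmp x y
      ... | tri< x<y x≢y y≮x
        rewrite imm-< z x<y | imm-≮ z y≮x | 𝟙-no (x Fin.≟ y) x≢y =
        trans (+-identityʳ _) (+-identityʳ _)
      ... | tri> x≮y x≢y y<x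
        rewrite imm-< z y<x | imm-≮ z x≮y | 𝟙-no (x Fin.≟ y) x≢y =
        trans (+-identityʳ _) (*-comm (arc z y) (arc z x))
      ... | tri≈ x≮y refl _
        rewrite imm-≮ z x≮y | 𝟙-yes (x Fin.≟ x) refl with arc? x z
      -- On the diagonal the claim is that `arc z x` equals its square, which holds for the values 0
      -- and 1.
      ... | yes _ = refl
      ... | no _  = refl

      -- Summing `parent-pairs` over all `x` and `y` counts every immorality at `z` twice, and the
      -- diagonal once per parent.
      vertex-count : ∀ z → let T = sum (λ x → sum (λ y → imm z x y)) in
        T + T + indegree D z ≡ indegree D z * indegree D z
      vertex-count z = begin
        T + T + indegree D z
          ≡⟨ cong₂ _+_ (cong (T +_) (∑-comm {n} {n} (imm z))) (sum-cong-≗ (λ x → sym (diagonal x))) ⟩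
        T + sum (λ x → sum (λ y → imm z y x)) + sum (λ x → sum (λ y → 𝟙 (x Fin.≟ y) * arc z x))
          ≡⟨ cong (_+ sum (λ x → sum (λ y → 𝟙 (x Fin.≟ y) * arc z x))) (∑-distrib-+ (λ x → sum (imm z x)) _) ⟨
        sum (λ x → sum (λ y → imm z x y) + sum (λ y → imm z y x))
          + sum (λ x → sum (λ y → 𝟙 (x Fin.≟ y) * arc z x))
          ≡⟨ ∑-distrib-+ (λ x → sum (λ y → imm z x y) + sum (λ y → imm z y x)) _ ⟨
        sum (λ x → sum (λ y → imm z x y) + sum (λ y → imm z y x) + sum (λ y → 𝟙 (x Fin.≟ y) * arc z x))
          ≡⟨ sum-cong-≗ row ⟩
        sum (λ x → arc z x * indegree D z)
          ≡⟨ *-distribʳ-sum (indegree D z) (arc z) ⟨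
        indegree D z * indegree D z ∎
        where
        open ≡-Reasoning
        T = sum (λ x → sum (λ y → imm z x y))

        diagonal : ∀ x → sum (λ y → 𝟙 (x Fin.≟ y) * arc z x) ≡ arc z x
        diagonal x = begin
          sum (λ y → 𝟙 (x Fin.≟ y) * arc z x)   ≡⟨ *-distribʳ-sum (arc z x) (λ y → 𝟙 (x Fin.≟ y)) ⟨
          sum (λ y → 𝟙 (x Fin.≟ y)) * arc z x   ≡⟨ cong (_* arc z x)
            (∑-𝟙-one (x Fin.≟_) (λ p q → trans (sym p) q) x refl) ⟩
          1 * arc z x                           ≡⟨ *-identityˡ _ ⟩
          arc z x                               ∎

        row : ∀ x → sum (λ y → imm z x y) + sum (λ y → imm z y x) + sum (λ y → 𝟙 (x Fin.≟ y) * arc z x)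
                    ≡ arc z x * indegree D z
        row x = begin
          sum (λ y → imm z x y) + sum (λ y → imm z y x) + sum (λ y → 𝟙 (x Fin.≟ y) * arc z x)
            ≡⟨ cong (_+ sum (λ y → 𝟙 (x Fin.≟ y) * arc z x)) (∑-distrib-+ (imm z x) _) ⟨
          sum (λ y → imm z x y + imm z y x) + sum (λ y → 𝟙 (x Fin.≟ y) * arc z x)
            ≡⟨ ∑-distrib-+ (λ y → imm z x y + imm z y x) _ ⟨
          sum (λ y → imm z x y + imm z y x + 𝟙 (x Fin.≟ y) * arc z x)
            ≡⟨ sum-cong-≗ (parent-pairs z x) ⟩
          sum (λ y → arc z x * arc z y)
            ≡⟨ *-distribˡ-sum (arc z x) (arc z) ⟨
          arc z x * indegree D z ∎

    immorality-count : let I = length (immoralities D) in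
      2 * I + sum (indegree D) ≡ sum (λ z → indegree D z * indegree D z)
    immorality-count = begin
      2 * I + sum (indegree D)                        ≡⟨ cong (λ k → 2 * k + sum (indegree D)) (length-immoralities D) ⟩
      2 * sum T + sum (indegree D)                    ≡⟨ cong (λ k → sum T + k + sum (indegree D)) (+-identityʳ (sum T)) ⟩
      sum T + sum T + sum (indegree D)                ≡⟨ cong (_+ sum (indegree D)) (∑-distrib-+ T T) ⟨
      sum (λ z → T z + T z) + sum (indegree D)        ≡⟨ ∑-distrib-+ (λ z → T z + T z) (indegree D) ⟨
      sum (λ z → T z + T z + indegree D z)            ≡⟨ sum-cong-≗ vertex-count ⟩
      sum (λ z → indegree D z * indegree D z)         ∎
      where
      open ≡-Reasoning
      I = length (immoralities D)
      T : Fin n → ℕ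
      T z = sum (λ x → sum (λ y → imm z x y))

-- Regular graphs

module _ (G : Graph n) {d m : ℕ} (regular : ∀ z → degree G z ≡ d) (n≡m*2 : n ≡ m * 2) where

  module _ (D : DAG n) (skel : IsSkeletonOf G D) where

    -- A d-regular graph on 2m vertices has m d edges, each oriented once.
    sum-indegree : sum (indegree D) ≡ m * d
    sum-indegree = *-cancelˡ-≡ _ _ 2 (begin
      2 * sum (indegree D)                    ≡⟨ cong (sum (indegree D) +_) (+-identityʳ _) ⟩
      sum (indegree D) + sum (indegree D)     ≡⟨ handshake G D skel ⟩
      sum (degree G)                          ≡⟨ sum-cong-≗ regular ⟩
      sum {n} (λ _ → d)                       ≡⟨ sum-const n d ⟩
      n * d                                   ≡⟨ cong (_* d) (trans n≡m*2 (*-comm m 2)) ⟩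
      2 * m * d                               ≡⟨ *-assoc 2 m d ⟩
      2 * (m * d)                             ∎)
      where open ≡-Reasoning

    module _ (tf : TriangleFree G) where

      private
        -- The left side is the value that the sum of squared in-degrees takes when every in-degree
        -- is 0 or `d`. The trailing sum on the right is kept to cancel against `immorality-count`.
        extremal : sum (λ z → d * indegree D z) ≡ 2 * (m * (d choose 2)) + sum (indegree D)
        extremal = begin
          sum (λ z → d * indegree D z)              ≡⟨ *-distribˡ-sum d (indegree D) ⟨
          d * sum (indegree D)                      ≡⟨ cong (d *_) sum-indegree ⟩
          d * (m * d)                               ≡⟨ swap d m ⟩
          m * (d * d)                               ≡⟨ cong (m *_) (2*choose2 d) ⟨
          m * (2 * (d choose 2) + d)                ≡⟨ distrib m (d choose 2) d ⟩
          2 * (m * (d choose 2)) + m * d            ≡⟨ cong (2 * (m * (d choose 2)) +_) sum-indegree ⟨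
          2 * (m * (d choose 2)) + sum (indegree D) ∎
          where
          open ≡-Reasoning
          swap : ∀ d m → d * (m * d) ≡ m * (d * d)
          swap = solve-∀
          distrib : ∀ m c d → m * (2 * c + d) ≡ 2 * (m * c) + m * d
          distrib = solve-∀

      -- One factor of each squared in-degree is bounded by the degree `d`.
      immoralities-≤ : length (immoralities D) ≤ m * (d choose 2)
      immoralities-≤ = *-cancelˡ-≤ 2 (+-cancelʳ-≤ (sum (indegree D)) _ _ (begin
        2 * length (immoralities D) + sum (indegree D)   ≡⟨ immorality-count G D skel tf ⟩
        sum (λ z → indegree D z * indegree D z)          ≤⟨ sum-mono-≤ (λ z → *-monoˡ-≤ (indegree D z)
          (≤-trans (indegree≤degree G D skel z) (≤-reflexive (regular z)))) ⟩
        sum (λ z → d * indegree D z)                     ≡⟨ extremal ⟩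
        2 * (m * (d choose 2)) + sum (indegree D)        ∎))
        where open ≤-Reasoning

      -- The hypothesis encodes that each in-degree is 0 or `d`, which makes the estimate in
      -- `immoralities-≤` an equality.
      immoralities-≡ : (∀ z → indegree D z * indegree D z ≡ d * indegree D z) →
        length (immoralities D) ≡ m * (d choose 2)
      immoralities-≡ eq = *-cancelˡ-≡ _ _ 2 (+-cancelʳ-≡ (sum (indegree D)) _ _
        (trans (immorality-count G D skel tf) (trans (sum-cong-≗ eq) extremal)))

  -- Orienting the edges away from an independent set

  module _ (S : Subset n) (indep : Independent G S) where
    open Graph G

    private
      -- Edges with no end in `S` also need an acyclic orientation; they follow the order of
      -- `Fin n`.
      SourceArc : Fin n → Fin n → Set
      SourceArc i j = Adj i j × j ∉ S × (i ∈ S ⊎ i Fin.< j)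

      -- Sources of consecutive arcs lie outside S, so a path increases after its first arc.
      path : ∀ {i j} → TransClosure SourceArc i j → j ∉ S × (i ∈ S ⊎ i Fin.< j)
      path [ _ , j∉S , i∈S⊎i<j ] = j∉S , i∈S⊎i<j
      path ((_ , k∉S , i∈S⊎i<k) ∷ p) with path p
      ... | j∉S , inj₁ k∈S = contradiction k∈S k∉S
      ... | j∉S , inj₂ k<j = j∉S , [ inj₁ , (λ i<k → inj₂ (<-trans i<k k<j)) ]′ i∈S⊎i<k

    sourceDAG : DAG n
    sourceDAG = record
      { Arc     = SourceArc
      ; arc?    = λ i j → adj? i j ×-dec ¬? (j ∈? S) ×-dec (i ∈? S ⊎-dec i Fin.<? j)
      -- A closed path would end outside `S`, hence also start there, and so lie strictly above its
      -- own start.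
      ; acyclic = λ i c → let i∉S , i∈S⊎i<i = path c in
                          [ i∉S , <-irrefl refl ]′ i∈S⊎i<i
      }

    sourceDAG-skeleton : IsSkeletonOf G sourceDAG
    sourceDAG-skeleton i j = mk⇔ orient [ proj₁ , adj-sym ∘ proj₁ ]′
      where
      orient : Adj i j → SourceArc i j ⊎ SourceArc j i
      orient e with i ∈? S | j ∈? S
      ... | yes i∈S | yes j∈S = contradiction e (indep i∈S j∈S)
      ... | yes i∈S | no  j∉S = inj₁ (e , j∉S , inj₁ i∈S)
      ... | no  i∉S | yes j∈S = inj₂ (adj-sym e , i∉S , inj₁ j∈S)
      ... | no  i∉S | no  j∉S with Fin.<-cmp i j
      ... | tri< i<j _ _ = inj₁ (e , j∉S , inj₂ i<j)
      ... | tri≈ _ refl _ = contradiction e (adj-irref i)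
      ... | tri> _ _ j<i = inj₂ (adj-sym e , i∉S , inj₂ j<i)

    module _ (∣S∣≡m : ∣ S ∣ ≡ m) where

      private
        bound : Fin n → ℕ
        bound z = 𝟙 (z ∈? ∁ S) * d

        indegree-∈ : ∀ {z} → z ∈ S → indegree sourceDAG z ≡ 0
        indegree-∈ {z} z∈S = ∑-𝟙-none (λ x → DAG.arc? sourceDAG x z)
          λ x (_ , z∉S , _) → z∉S z∈S

        indegree≤bound : ∀ z → Dec (z ∈ S) → indegree sourceDAG z ≤ bound z
        indegree≤bound z (yes z∈S) = ≤-trans (≤-reflexive (indegree-∈ z∈S)) z≤n
        indegree≤bound z (no z∉S) = begin
          indegree sourceDAG z   ≤⟨ indegree≤degree G sourceDAG sourceDAG-skeleton z ⟩
          degree G z             ≡⟨ regular z ⟩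
          d                      ≡⟨ *-identityˡ d ⟨
          1 * d                  ≡⟨ cong (_* d) (𝟙-yes (z ∈? ∁ S) (x∉p⇒x∈∁p z∉S)) ⟨
          bound z                ∎
          where open ≤-Reasoning

        -- The complement of `S` has 2m - m vertices. The result equals the number of arcs, so the
        -- bounds leave no slack.
        sum-bound : sum bound ≡ m * d
        sum-bound = begin
          sum bound                          ≡⟨ *-distribʳ-sum d (λ z → 𝟙 (z ∈? ∁ S)) ⟨
          sum (λ z → 𝟙 (z ∈? ∁ S)) * d       ≡⟨ cong (_* d) (∑-𝟙-∈ (∁ S)) ⟩
          ∣ ∁ S ∣ * d                        ≡⟨ cong (_* d) (∣∁p∣≡n∸∣p∣ S) ⟩
          (n ∸ ∣ S ∣) * d                    ≡⟨ cong (_* d) (cong₂ _∸_ n≡m*2 ∣S∣≡m) ⟩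
          (m * 2 ∸ m) * d                    ≡⟨ cong (λ k → (k ∸ m) * d) (*-comm m 2) ⟩
          (m + (m + 0) ∸ m) * d              ≡⟨ cong (_* d) (m+n∸m≡n m (m + 0)) ⟩
          (m + 0) * d                        ≡⟨ cong (_* d) (+-identityʳ m) ⟩
          m * d                              ∎
          where open ≡-Reasoning

      -- No in-degree exceeds its bound and the totals agree, so every bound is attained. In
      -- particular every edge joins `S` to its complement.
      indegree-sourceDAG : ∀ z → indegree sourceDAG z ≡ 𝟙 (z ∈? ∁ S) * d
      indegree-sourceDAG = sum-≡⇒≗ (λ z → indegree≤bound z (z ∈? S))
        (trans (sum-indegree sourceDAG sourceDAG-skeleton) (sym sum-bound))

      immoralities-sourceDAG : TriangleFree G →
        length (immoralities sourceDAG) ≡ m * (d choose 2)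
      immoralities-sourceDAG tf = immoralities-≡ sourceDAG sourceDAG-skeleton tf
        λ z → subst (λ k → k * k ≡ d * k) (sym (indegree-sourceDAG z)) (zero-or-d (z ∈? ∁ S))
        where
        zero-or-d : {P : Set} (P? : Dec P) → 𝟙 P? * d * (𝟙 P? * d) ≡ d * (𝟙 P? * d)
        zero-or-d (yes _) = cong (_* (1 * d)) (*-identityˡ d)
        zero-or-d (no _)  = sym (*-zeroʳ d)

  regular-immoralityNumber : TriangleFree G → IsIndependenceNumber G m →
    IsImmoralityNumber G (m * (d choose 2))
  regular-immoralityNumber tf (((S , indep) , ∣S∣≡m) , _) =
      ((sourceDAG S indep , sourceDAG-skeleton S indep) , immoralities-sourceDAG S indep ∣S∣≡m tf)
    , λ (D , skel) → immoralities-≤ D skel tf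

-- Degrees in circulant graphs

module _ {p : ℕ} where

  -- Signed divisibility supplies closure under subtraction. The separate `k` lets each use give the
  -- difference in simplified form.
  difference-∣ : ∀ {i j k : ℤ} → p ∣ ℤ.∣ i ∣ → p ∣ ℤ.∣ j ∣ → i ℤ.- j ≡ k → p ∣ ℤ.∣ k ∣
  difference-∣ {i} {j} p∣i p∣j refl = ℤ.∣⇒∣ᵤ {ℤ.+ p} {i ℤ.- j}
    (ℤ.∣m∣n⇒∣m-n (ℤ.∣ᵤ⇒∣ {ℤ.+ p} {i} p∣i) (ℤ.∣ᵤ⇒∣ {ℤ.+ p} {j} p∣j))

  -- The distance of `x` and `y` is at most their maximum, hence below `p`, and the only such
  -- multiple of `p` is 0.
  residue-unique : ∀ {x y} → x < p → y < p → p ∣ ℤ.∣ ℤ.+ x ℤ.- ℤ.+ y ∣ → x ≡ y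
  residue-unique {x} {y} x<p y<p p∣ with ℤ.∣ ℤ.+ x ℤ.- ℤ.+ y ∣ in eq
  ... | zero  = ℤ.+-injective (ℤ.i-j≡0⇒i≡j (ℤ.+ x) (ℤ.+ y) (ℤ.∣i∣≡0⇒i≡0 eq))
  ... | suc k = contradiction p∣ (>⇒∤ (subst (_< p) eq (begin-strict
    ℤ.∣ ℤ.+ x ℤ.- ℤ.+ y ∣ ≡⟨ cong ℤ.∣_∣ (ℤ.m-n≡m⊖n x y) ⟩
    ℤ.∣ x ℤ.⊖ y ∣         ≤⟨ ℤ.∣m⊝n∣≤m⊔n x y ⟩
    x ⊔ y                 <⟨ ⊔-pres-<m x<p y<p ⟩
    p                     ∎)))
    where open ≤-Reasoning

  shift-unique : ∀ z c {x y : Fin p} →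
    p ∣ ℤ.∣ (ℤ.+ toℕ x ℤ.- z) ℤ.- c ∣ → p ∣ ℤ.∣ (ℤ.+ toℕ y ℤ.- z) ℤ.- c ∣ → x ≡ y
  shift-unique z c {x} {y} p∣x p∣y = Fin.toℕ-injective (residue-unique (Fin.toℕ<n x) (Fin.toℕ<n y)
    (difference-∣ {(ℤ.+ toℕ x ℤ.- z) ℤ.- c} {(ℤ.+ toℕ y ℤ.- z) ℤ.- c} p∣x p∣y
      (lemma (ℤ.+ toℕ x) (ℤ.+ toℕ y) z c)))
    where
    lemma : ∀ x y z c → ((x ℤ.- z) ℤ.- c) ℤ.- ((y ℤ.- z) ℤ.- c) ≡ x ℤ.- y
    lemma = ℤ.solve-∀

  -- The solution is the remainder `r` of `z + c`. With quotient `q`, the difference r - z - c is -q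
  -- p.
  shift-count : .{{_ : NonZero p}} → ∀ z c →
    sum {p} (λ x → 𝟙 (p ∣? ℤ.∣ (ℤ.+ toℕ x ℤ.- z) ℤ.- c ∣)) ≡ 1
  shift-count z c = ∑-𝟙-one (λ x → p ∣? ℤ.∣ (ℤ.+ toℕ x ℤ.- z) ℤ.- c ∣) (shift-unique z c) (fromℕ< r<p)
    (ℤ.∣⇒∣ᵤ {ℤ.+ p} {(ℤ.+ toℕ (fromℕ< r<p) ℤ.- z) ℤ.- c} (ℤ.divides (ℤ.- q) (begin
      (ℤ.+ toℕ (fromℕ< r<p) ℤ.- z) ℤ.- c     ≡⟨ cong (λ k → (ℤ.+ k ℤ.- z) ℤ.- c) (Fin.toℕ-fromℕ< r<p) ⟩
      (ℤ.+ r ℤ.- z) ℤ.- c                    ≡⟨ regroup (ℤ.+ r) z c ⟩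
      ℤ.+ r ℤ.- (z ℤ.+ c)                    ≡⟨ cong (λ t → ℤ.+ r ℤ.- t) (ℤ.a≡a%ℕn+[a/ℕn]*n (z ℤ.+ c) p) ⟩
      ℤ.+ r ℤ.- (ℤ.+ r ℤ.+ q ℤ.* ℤ.+ p)      ≡⟨ cancel (ℤ.+ r) q (ℤ.+ p) ⟩
      ℤ.- q ℤ.* ℤ.+ p                        ∎)))
    where
    open ≡-Reasoning
    r = (z ℤ.+ c) ℤ.%ℕ p
    q = (z ℤ.+ c) ℤ./ℕ p
    r<p : r < p
    r<p = ℤ.n%ℕd<d (z ℤ.+ c) p
    regroup : ∀ r z c → (r ℤ.- z) ℤ.- c ≡ r ℤ.- (z ℤ.+ c)
    regroup = ℤ.solve-∀
    cancel : ∀ r q p → r ℤ.- (r ℤ.+ q ℤ.* p) ≡ ℤ.- q ℤ.* p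
    cancel = ℤ.solve-∀

-- Neighbours when the connection set avoids p / 2

module _ (p : ℕ) (C : Subset (p / 2)) (2∣p : 2 ∣ p) (2c≢p : ∀ k → k ∈ C → 2 * value k ≢ p) where

  2*value<p : ∀ {k} → k ∈ C → 2 * value k < p
  2*value<p {k} k∈C = ≤∧≢⇒< (begin
    2 * value k     ≤⟨ *-monoʳ-≤ 2 (Fin.toℕ<n k) ⟩
    2 * (p / 2)     ≡⟨ *-comm 2 (p / 2) ⟩
    p / 2 * 2       ≡⟨ m/n*n≡m 2∣p ⟩
    p               ∎) (2c≢p k k∈C)
    where open ≤-Reasoning

  value-unique : ∀ {k l} → k ∈ C → l ∈ C → p ∣ ℤ.∣ ℤ.+ value k ℤ.- ℤ.+ value l ∣ → k ≡ l
  value-unique k∈C l∈C p∣ = Fin.toℕ-injective (suc-injective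
    (residue-unique (value<p k∈C) (value<p l∈C) p∣))
    where
    value<p : ∀ {k} → k ∈ C → value k < p
    value<p {k} k∈C = ≤-<-trans (m≤m+n (value k) _) (2*value<p k∈C)

  -- Otherwise `p` would divide `value k + value l`, which is positive and, both summands being
  -- below p / 2, less than `p`.
  opposite-signs : ∀ {k l} → k ∈ C → l ∈ C → ∀ s →
    p ∣ ℤ.∣ s ℤ.- ℤ.+ value k ∣ → ¬ p ∣ ℤ.∣ s ℤ.- ℤ.- ℤ.+ value l ∣
  opposite-signs {k} {l} k∈C l∈C s p∣k p∣l = >⇒∤ sum<p
    (difference-∣ {i = s ℤ.- ℤ.- ℤ.+ value l} {j = s ℤ.- ℤ.+ value k} p∣l p∣k
      (trans (lemma s (ℤ.+ value k) (ℤ.+ value l)) (sym (ℤ.pos-+ (value k) (value l)))))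
    where
    lemma : ∀ s a b → (s ℤ.- ℤ.- b) ℤ.- (s ℤ.- a) ≡ a ℤ.+ b
    lemma = ℤ.solve-∀
    double : ∀ a b → 2 * (a + b) ≡ 2 * a + 2 * b
    double = solve-∀
    sum<p : value k + value l < p
    sum<p = *-cancelˡ-< 2 _ _ (begin-strict
      2 * (value k + value l)         ≡⟨ double (value k) (value l) ⟩
      2 * value k + 2 * value l       <⟨ +-mono-< (2*value<p k∈C) (2*value<p l∈C) ⟩
      p + p                           ≡⟨ cong (p +_) (+-identityʳ p) ⟨
      2 * p                           ∎)
      where open ≤-Reasoning

  private
    -- Adjacency with its witness exposed: `CirculantAdj p C x z` unfolds to `∃ (AdjVia x z)`.
    AdjVia : Fin p → Fin p → Fin (p / 2) → Set
    AdjVia x z k = k ∈ C ×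
      ( ℤ.+ toℕ x ℤ.- ℤ.+ toℕ z ≡ ℤ.+ value k [mod p ]
      ⊎ ℤ.+ toℕ x ℤ.- ℤ.+ toℕ z ≡ ℤ.- ℤ.+ value k [mod p ])

    plus? : ∀ x z k → Dec (ℤ.+ toℕ {p} x ℤ.- ℤ.+ toℕ {p} z ≡ ℤ.+ value {p / 2} k [mod p ])
    plus? x z k = p ∣? _

    minus? : ∀ x z k → Dec (ℤ.+ toℕ {p} x ℤ.- ℤ.+ toℕ {p} z ≡ ℤ.- ℤ.+ value {p / 2} k [mod p ])
    minus? x z k = p ∣? _

    adjVia? : ∀ x z k → Dec (AdjVia x z k)
    adjVia? x z k = k ∈? C ×-dec (plus? x z k ⊎-dec minus? x z k)

    adjVia-unique : ∀ x z {k l} → AdjVia x z k → AdjVia x z l → k ≡ l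
    adjVia-unique x z {k} {l} (k∈C , e) (l∈C , f) with e | f
    ... | inj₁ e | inj₂ f = contradiction f (opposite-signs k∈C l∈C (ℤ.+ toℕ x ℤ.- ℤ.+ toℕ z) e)
    ... | inj₂ e | inj₁ f = contradiction e (opposite-signs l∈C k∈C (ℤ.+ toℕ x ℤ.- ℤ.+ toℕ z) f)
    ... | inj₁ e | inj₁ f = value-unique k∈C l∈C
      (difference-∣ {i = s ℤ.- ℤ.+ value l} {j = s ℤ.- ℤ.+ value k} f e (lemma s (ℤ.+ value k) (ℤ.+ value l)))
      where
      s = ℤ.+ toℕ x ℤ.- ℤ.+ toℕ z
      lemma : ∀ s a b → (s ℤ.- b) ℤ.- (s ℤ.- a) ≡ a ℤ.- b
      lemma = ℤ.solve-∀
    -- Under minus signs the order of subtraction is reversed, so that the difference is again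
    -- `value k` minus `value l`.
    ... | inj₂ e | inj₂ f = value-unique k∈C l∈C
      (difference-∣ {i = s ℤ.- ℤ.- ℤ.+ value k} {j = s ℤ.- ℤ.- ℤ.+ value l} e f (lemma s (ℤ.+ value k) (ℤ.+ value l)))
      where
      s = ℤ.+ toℕ x ℤ.- ℤ.+ toℕ z
      lemma : ∀ s a b → (s ℤ.- ℤ.- a) ℤ.- (s ℤ.- ℤ.- b) ≡ a ℤ.- b
      lemma = ℤ.solve-∀

    -- The two signs exclude each other, by `opposite-signs` at equal indices, so the disjunction
    -- becomes a sum.
    𝟙-adjVia : ∀ x z k → 𝟙 (adjVia? x z k) ≡ 𝟙 (k ∈? C) * (𝟙 (plus? x z k) + 𝟙 (minus? x z k))
    𝟙-adjVia x z k with k ∈? C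
    ... | no _    = refl
    ... | yes k∈C = trans
      (𝟙-⊎ (λ (e , f) → opposite-signs k∈C k∈C (ℤ.+ toℕ x ℤ.- ℤ.+ toℕ z) e f) (plus? x z k) (minus? x z k))
      (sym (*-identityˡ _))

  -- Double counting of pairs (x, k): each neighbour `x` comes from one `k`, and each element c of
  -- the connection set yields z + c and z - c. These differ because 2c is not `p`; for c = p / 2
  -- they would coincide and the degree would drop by one.
  degree-circulant : ∀ z → degree (Circulant p C) z ≡ 2 * ∣ C ∣
  degree-circulant z = begin
    degree (Circulant p C) z
      ≡⟨ sum-cong-≗ (λ x → sym (∑-𝟙-unique (adjVia? x z) (adjVia-unique x z) (Graph.adj? (Circulant p C) x z))) ⟩
    sum (λ x → sum (λ k → 𝟙 (adjVia? x z k)))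
      ≡⟨ ∑-comm (λ x k → 𝟙 (adjVia? x z k)) ⟩
    sum (λ k → sum (λ x → 𝟙 (adjVia? x z k)))
      ≡⟨ sum-cong-≗ (λ k → sum-cong-≗ (λ x → 𝟙-adjVia x z k)) ⟩
    sum (λ k → sum (λ x → 𝟙 (k ∈? C) * (𝟙 (plus? x z k) + 𝟙 (minus? x z k))))
      ≡⟨ sum-cong-≗ two-neighbours ⟩
    sum (λ k → 𝟙 (k ∈? C) * 2)
      ≡⟨ *-distribʳ-sum 2 (λ k → 𝟙 (k ∈? C)) ⟨
    sum (λ k → 𝟙 (k ∈? C)) * 2
      ≡⟨ cong (_* 2) (∑-𝟙-∈ C) ⟩
    ∣ C ∣ * 2
      ≡⟨ *-comm ∣ C ∣ 2 ⟩
    2 * ∣ C ∣ ∎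
    where
    open ≡-Reasoning
    instance
      p≢0 : NonZero p
      -- The vertex `z` witnesses that `p` is nonzero, so remainders modulo `p` exist.
      p≢0 = Fin.nonZeroIndex z

    two-neighbours : ∀ k →
      sum (λ x → 𝟙 (k ∈? C) * (𝟙 (plus? x z k) + 𝟙 (minus? x z k))) ≡ 𝟙 (k ∈? C) * 2
    two-neighbours k = begin
      sum (λ x → 𝟙 (k ∈? C) * (𝟙 (plus? x z k) + 𝟙 (minus? x z k)))
        ≡⟨ *-distribˡ-sum (𝟙 (k ∈? C)) (λ x → 𝟙 (plus? x z k) + 𝟙 (minus? x z k)) ⟨
      𝟙 (k ∈? C) * sum (λ x → 𝟙 (plus? x z k) + 𝟙 (minus? x z k))
        ≡⟨ cong (𝟙 (k ∈? C) *_) (∑-distrib-+ (λ x → 𝟙 (plus? x z k)) (λ x → 𝟙 (minus? x z k))) ⟩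
      𝟙 (k ∈? C) * (sum (λ x → 𝟙 (plus? x z k)) + sum (λ x → 𝟙 (minus? x z k)))
        ≡⟨ cong (𝟙 (k ∈? C) *_) (cong₂ _+_
             (shift-count {p} (ℤ.+ toℕ z) (ℤ.+ value k)) (shift-count {p} (ℤ.+ toℕ z) (ℤ.- ℤ.+ value k))) ⟩
      𝟙 (k ∈? C) * 2 ∎

corollary2p11 : (p : ℕ) → 2 ∣ p → (C : Subset (p / 2)) →
    (∀ k → k ∈ C → 2 * value k ≢ p) →
    TriangleFree (Circulant p C) →
    Cycle (Circulant p C) p →
    IsIndependenceNumber (Circulant p C) (p / 2) →
    IsImmoralityNumber (Circulant p C) (p / 2 * ((2 * ∣ C ∣) choose 2))
corollary2p11 p 2∣p C 2c≢p tf _ =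
  -- The regular case with d = `2 * ∣ C ∣` and m = `p / 2`.
  regular-immoralityNumber (Circulant p C)
    (degree-circulant p C 2∣p 2c≢p) (sym (m/n*n≡m 2∣p)) tf
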